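{- Let $p$ be a prime with $p\equiv 5\pmod 6$ and $1667\leq p\leq 2039$. Then there exists a lattice of dimension $n=2p-2$ whose center density is larger than $\frac{((p+1)/12)^{p-1}}{p^{(p-5)/6}}$.
   Context: For a lattice ${\bf L}$ of rank $r$ with shortest nonzero vector length $\lambda$ and volume $\mathrm{Vol}({\bf L})$ (square root of the Gram determinant of a basis), the center density is $(\lambda/2)^r/\mathrm{Vol}({\bf L})$. -}

module Defs where

open import Data.Nat as ℕ using (ℕ; zero; suc)
open import Data.Integer as ℤ using (ℤ; +_)
open import Data.Rational as Q using (ℚ; 0ℚ; 1ℚ; _+_; _*_; -_; _<_; _≤_; _>_)
open import Data.Fin using (Fin; zero; suc; punchIn)
open import Data.Product using (Σ; _×_; ∃; _,_)
open import Relation.Binary.PropositionalEquality using (_≡_)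
open import Relation.Nullary using (¬_)

_^ℚ_ : ℚ → ℕ → ℚ
q ^ℚ zero  = 1ℚ
q ^ℚ suc n = q * (q ^ℚ n)

sumFin : (n : ℕ) → (Fin n → ℚ) → ℚ
sumFin zero    f = 0ℚ
sumFin (suc n) f = f zero + sumFin n (λ i → f (suc i))

Matrix : ℕ → Set
Matrix n = Fin n → Fin n → ℚ

sign : ℕ → ℚ
sign zero    = 1ℚ
sign (suc j) = - sign j

minor : {n : ℕ} → Matrix (suc n) → Fin (suc n) → Matrix n
minor M j r c = M (suc r) (punchIn j c)

det : (n : ℕ) → Matrix n → ℚ
det zero    M = 1ℚ
det (suc n) M =
  sumFin (suc n) (λ j → sign (Data.Fin.toℕ j) * (M zero j * det n (minor M j)))

quadForm : (n : ℕ) → Matrix n → (Fin n → ℚ) → ℚ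
quadForm n G x = sumFin n (λ i → sumFin n (λ j → x i * (G i j * x j)))

Symmetric : (n : ℕ) → Matrix n → Set
Symmetric n G = ∀ i j → G i j ≡ G j i

NonZeroVec : (n : ℕ) → (Fin n → ℚ) → Set
NonZeroVec n x = ¬ (∀ i → x i ≡ 0ℚ)

-- Gram matrix of a basis of a lattice of rank n (symmetric positive definite)
IsGram : (n : ℕ) → Matrix n → Set
IsGram n G = Symmetric n G × (∀ (x : Fin n → ℚ) → NonZeroVec n x → 0ℚ < quadForm n G x)

intVec : (n : ℕ) → (Fin n → ℤ) → (Fin n → ℚ)
intVec n x i = x i Q./ 1

IsMinNormSq : (n : ℕ) → Matrix n → ℚ → Set
IsMinNormSq n G m =
  (∀ (x : Fin n → ℤ) → NonZeroVec n (intVec n x) → m ≤ quadForm n G (intVec n x))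
  × Σ (Fin n → ℤ) (λ x → NonZeroVec n (intVec n x) × quadForm n G (intVec n x) ≡ m)

-- "center density of the lattice (G, λ² = m) of rank n is larger than A / B"
-- where A, B > 0.  Center density δ = (λ/2)^n / sqrt(det G), so
-- δ² = ((λ/2)^n)² / det G = (m/4)^n / det G; we compare squares (both sides positive):
-- δ > A/B  ⇔  (m/4)^n · B² > A² · det G.
CenterDensityExceeds : (n : ℕ) → Matrix n → (m A B : ℚ) → Set
CenterDensityExceeds n G m A B =
  ((m * (+ 1 Q./ 4)) ^ℚ n) * (B * B) > (A * A) * det n G

{-# OPTIONS --safe #-}
-- A greedy (Gilbert–Varshamov type) construction already beats the required density.
-- For Q = 37^K take the lattice of all v = (y₁,…,yₙ₋₁,w) ∈ ℤⁿ with h₁y₁ + … + hₙ₋₁yₙ₋₁ + w ≡ 0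
-- (mod Q); its Gram determinant is Q². The coefficients are chosen one after the other
-- so that no nonzero vector of norm less than 37² appears: a vector whose new coordinate y is
-- nonzero has |y| < 37, so y is invertible modulo Q and the vector excludes only one residue of
-- the new coefficient; hence a free residue exists as long as the ball contains fewer than Q
-- integer vectors. Starting from the plane lattice with coefficient Q / 37, which contains
-- (37 , 0), makes the minimal norm exactly 37². For n ≥ 3332 the number of integer vectors in
-- the ball is so small that the exponent K = p / 3 + 390 leaves room on both sides.
module Submission where

open import Defs

-- Determinants by Laplace expansion: alternation, row linearity, triangular products.

module Determinants where
  open import Data.Nat.Base as ℕ using (ℕ; zero; suc)
  open import Data.Fin.Base using (Fin; zero; suc; toℕ; punchIn; pinch)
  open import Data.Rational.Base as Q using (ℚ; 0ℚ; 1ℚ; _+_; _*_; -_)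
  import Data.Rational.Properties as Q
  open import Relation.Nullary.Decidable using (dec⇒maybe)
  open import Data.Product.Base using (_×_; _,_)
  open import Data.Unit.Base using (⊤)
  open import Data.Vec.Functional using (Vector; _∷_)
  open import Function.Base using (_∘_)
  open import Relation.Binary.PropositionalEquality
  open import Tactic.RingSolver using (solve-∀)
  open import Tactic.RingSolver.Core.AlmostCommutativeRing
    using (AlmostCommutativeRing; fromCommutativeRing)

  ℚ-ring : AlmostCommutativeRing _ _
  ℚ-ring = fromCommutativeRing Q.+-*-commutativeRing (λ x → dec⇒maybe (0ℚ Q.≟ x))

  open ≡-Reasoning

  sum-cong : ∀ n {f g : Fin n → ℚ} → (∀ i → f i ≡ g i) → sumFin n f ≡ sumFin n g
  sum-cong zero    eq = refl
  sum-cong (suc n) eq = cong₂ _+_ (eq zero) (sum-cong n (eq ∘ suc))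

  sum-0 : ∀ n → sumFin n (λ _ → 0ℚ) ≡ 0ℚ
  sum-0 zero    = refl
  sum-0 (suc n) = trans (Q.+-identityˡ _) (sum-0 n)

  sum-+ : ∀ n (f g : Fin n → ℚ) →
    sumFin n (λ i → f i + g i) ≡ sumFin n f + sumFin n g
  sum-+ zero    f g = refl
  sum-+ (suc n) f g =
    trans (cong (f zero + g zero +_) (sum-+ n (f ∘ suc) (g ∘ suc)))
      (interchange (f zero) (g zero) (sumFin n (f ∘ suc)) (sumFin n (g ∘ suc)))
    where
    interchange : ∀ a b c d → a + b + (c + d) ≡ a + c + (b + d)
    interchange = solve-∀ ℚ-ring

  sum-*ˡ : ∀ n c (f : Fin n → ℚ) → sumFin n (λ i → c * f i) ≡ c * sumFin n f
  sum-*ˡ zero    c f = sym (Q.*-zeroʳ c)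
  sum-*ˡ (suc n) c f =
    trans (cong (c * f zero +_) (sum-*ˡ n c (f ∘ suc)))
      (sym (Q.*-distribˡ-+ c (f zero) (sumFin n (f ∘ suc))))

  sum-*ʳ : ∀ n c (f : Fin n → ℚ) → sumFin n (λ i → f i * c) ≡ sumFin n f * c
  sum-*ʳ n c f =
    trans (sum-cong n (λ i → Q.*-comm (f i) c)) (trans (sum-*ˡ n c f) (Q.*-comm c _))

  sum-swap : ∀ m n (f : Fin m → Fin n → ℚ) →
    sumFin m (λ i → sumFin n (f i)) ≡ sumFin n (λ j → sumFin m (λ i → f i j))
  sum-swap zero    n f = sym (sum-0 n)
  sum-swap (suc m) n f =
    trans (cong (sumFin n (f zero) +_) (sum-swap m n (f ∘ suc)))
      (sym (sum-+ n (f zero) (λ j → sumFin m (λ i → f (suc i) j))))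

  -- Deleting first column j and then column l of the rest is the same as deleting
  -- first column punchIn j l and then column pinch l j.
  sum-transpose : ∀ n (f : Fin (suc n) → Fin n → ℚ) →
    sumFin (suc n) (λ j → sumFin n (λ l → f (punchIn j l) (pinch l j)))
      ≡ sumFin (suc n) (λ j → sumFin n (f j))
  sum-transpose zero    f = refl
  sum-transpose (suc n) f = begin
    S₁ + sumFin (suc n) (λ j → f zero j + sumFin n (λ l → g (punchIn j l) (pinch l j)))
      ≡⟨ cong (S₁ +_) (sum-+ (suc n) (f zero)
           (λ j → sumFin n (λ l → g (punchIn j l) (pinch l j)))) ⟩
    S₁ + (S₀ + sumFin (suc n) (λ j → sumFin n (λ l → g (punchIn j l) (pinch l j))))
      ≡⟨ cong (λ z → S₁ + (S₀ + z)) (sum-transpose n g) ⟩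
    S₁ + (S₀ + S)
      ≡⟨ rearrange S₁ S₀ S ⟩
    S₀ + (S₁ + S)
      ≡⟨ cong (S₀ +_) (sum-+ (suc n) (λ j → f (suc j) zero) (λ j → sumFin n (g j))) ⟨
    S₀ + sumFin (suc n) (λ j → f (suc j) zero + sumFin n (g j)) ∎
    where
    g : Fin (suc n) → Fin n → ℚ
    g j l = f (suc j) (suc l)
    S₀ = sumFin (suc n) (f zero)
    S₁ = sumFin (suc n) (λ j → f (suc j) zero)
    S  = sumFin (suc n) (λ j → sumFin n (g j))
    rearrange : ∀ a b c → a + (b + c) ≡ b + (a + c)
    rearrange = solve-∀ ℚ-ring

  punchIn-pinch : ∀ {n} (j : Fin (suc n)) (l : Fin n) → punchIn (punchIn j l) (pinch l j) ≡ j
  punchIn-pinch zero    zero    = refl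
  punchIn-pinch zero    (suc l) = refl
  punchIn-pinch (suc j) zero    = refl
  punchIn-pinch (suc j) (suc l) = cong suc (punchIn-pinch j l)

  punchIn-punchIn-comm : ∀ {n} (j : Fin (suc (suc n))) (l : Fin (suc n)) (x : Fin n) →
    punchIn (punchIn j l) (punchIn (pinch l j) x) ≡ punchIn j (punchIn l x)
  punchIn-punchIn-comm zero    zero    x       = refl
  punchIn-punchIn-comm zero    (suc l) x       = refl
  punchIn-punchIn-comm (suc j) zero    x       = refl
  punchIn-punchIn-comm (suc j) (suc l) zero    = refl
  punchIn-punchIn-comm (suc j) (suc l) (suc x) = cong suc (punchIn-punchIn-comm j l x)

  -- Exactly one of the two positions moves by one: if `j ≤ l`, then `l` becomes `l + 1` and `j`
  -- stays; otherwise `j` becomes `j - 1` and `l` stays. So the parity of the sum of the positions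
  -- flips.
  sign-transpose : ∀ {n} (j : Fin (suc n)) (l : Fin n) →
    sign (toℕ (punchIn j l)) * sign (toℕ (pinch l j)) ≡ - (sign (toℕ j) * sign (toℕ l))
  sign-transpose {suc _} zero    l       = base (sign (toℕ l))
    where
    base : ∀ s → - s * 1ℚ ≡ - (1ℚ * s)
    base = solve-∀ ℚ-ring
  sign-transpose {suc _} (suc j) zero    = base (sign (toℕ j))
    where
    base : ∀ s → 1ℚ * s ≡ - (- s * 1ℚ)
    base = solve-∀ ℚ-ring
  sign-transpose {suc _} (suc j) (suc l) =
    trans (neg*neg (sign (toℕ (punchIn j l))) (sign (toℕ (pinch l j))))
      (trans (sign-transpose j l) (cong -_ (sym (neg*neg (sign (toℕ j)) (sign (toℕ l))))))
    where
    neg*neg : ∀ s t → - s * - t ≡ s * t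
    neg*neg = solve-∀ ℚ-ring

  det-cong : ∀ n {M N : Matrix n} → (∀ i j → M i j ≡ N i j) → det n M ≡ det n N
  det-cong zero    eq = refl
  det-cong (suc n) eq = sum-cong (suc n) λ j → cong (sign (toℕ j) *_)
    (cong₂ _*_ (eq zero j) (det-cong n (λ r c → eq (suc r) (punchIn j c))))

  -- Laplace expansion along the first two rows turns both sides into double sums over the two
  -- deleted columns. Deleting the same columns in the opposite order leaves the double minor
  -- unchanged, exchanges the roles of `r` and `s`, and flips the sign.
  det-swap : ∀ n (r s : Vector ℚ (suc (suc n))) (R : Fin n → Vector ℚ (suc (suc n))) →
    det (suc (suc n)) (r ∷ s ∷ R) ≡ - det (suc (suc n)) (s ∷ r ∷ R)
  det-swap n r s R = begin
    det (suc (suc n)) (r ∷ s ∷ R)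
      ≡⟨ double-expansion r s ⟩
    sumFin (suc (suc n)) (λ j → sumFin (suc n) (K r s j))
      ≡⟨ sum-cong (suc (suc n)) (λ j → sum-cong (suc n) (K-transpose j)) ⟩
    sumFin (suc (suc n)) (λ j → sumFin (suc n) (λ l → - 1ℚ * Kˢ j l))
      ≡⟨ sum-cong (suc (suc n)) (λ j → sum-*ˡ (suc n) (- 1ℚ) (Kˢ j)) ⟩
    sumFin (suc (suc n)) (λ j → - 1ℚ * sumFin (suc n) (Kˢ j))
      ≡⟨ sum-*ˡ (suc (suc n)) (- 1ℚ) (λ j → sumFin (suc n) (Kˢ j)) ⟩
    - 1ℚ * sumFin (suc (suc n)) (λ j → sumFin (suc n) (Kˢ j))
      ≡⟨ cong (- 1ℚ *_) (sum-transpose (suc n) (K s r)) ⟩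
    - 1ℚ * sumFin (suc (suc n)) (λ j → sumFin (suc n) (K s r j))
      ≡⟨ -1* _ ⟩
    - sumFin (suc (suc n)) (λ j → sumFin (suc n) (K s r j))
      ≡⟨ cong -_ (double-expansion s r) ⟨
    - det (suc (suc n)) (s ∷ r ∷ R) ∎
    where
    D : Fin (suc (suc n)) → Fin (suc n) → ℚ
    D j l = det n (λ i x → R i (punchIn j (punchIn l x)))

    K : (r s : Vector ℚ (suc (suc n))) → Fin (suc (suc n)) → Fin (suc n) → ℚ
    K r s j l = (sign (toℕ j) * sign (toℕ l)) * ((r j * s (punchIn j l)) * D j l)

    Kˢ : Fin (suc (suc n)) → Fin (suc n) → ℚ
    Kˢ j l = K s r (punchIn j l) (pinch l j)

    -1* : ∀ x → - 1ℚ * x ≡ - x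
    -1* = solve-∀ ℚ-ring

    double-expansion : ∀ r s →
      det (suc (suc n)) (r ∷ s ∷ R) ≡ sumFin (suc (suc n)) (λ j → sumFin (suc n) (K r s j))
    double-expansion r s = sum-cong (suc (suc n)) λ j →
      trans (sym (Q.*-assoc (sign (toℕ j)) (r j) _))
        (trans (sym (sum-*ˡ (suc n) (sign (toℕ j) * r j)
                  (λ l → sign (toℕ l) * (s (punchIn j l) * D j l))))
          (sum-cong (suc n) λ l →
            regroup (sign (toℕ j)) (r j) (sign (toℕ l)) (s (punchIn j l)) (D j l)))
      where
      regroup : ∀ a b c d e → (a * b) * (c * (d * e)) ≡ (a * c) * ((b * d) * e)
      regroup = solve-∀ ℚ-ring

    K-transpose : ∀ j l → K r s j l ≡ - 1ℚ * K s r (punchIn j l) (pinch l j)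
    K-transpose j l = begin
      (sign (toℕ j) * sign (toℕ l)) * ((r j * s (punchIn j l)) * D j l)
        ≡⟨ regroup (sign (toℕ j) * sign (toℕ l)) (r j) (s (punchIn j l)) (D j l) ⟩
      - 1ℚ * (- (sign (toℕ j) * sign (toℕ l)) * ((s (punchIn j l) * r j) * D j l))
        ≡⟨ cong (- 1ℚ *_) (cong₂ _*_ (sign-transpose j l)
             (cong₂ _*_ (cong (λ c → s (punchIn j l) * r c) (punchIn-pinch j l))
               (det-cong n λ i x → cong (R i) (punchIn-punchIn-comm j l x)))) ⟨
      - 1ℚ * K s r (punchIn j l) (pinch l j) ∎
      where
      regroup : ∀ a b c d → a * ((b * c) * d) ≡ - 1ℚ * (- a * ((c * b) * d))
      regroup = solve-∀ ℚ-ring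

  x≡-x⇒x≡0 : ∀ x → x ≡ - x → x ≡ 0ℚ
  x≡-x⇒x≡0 x eq = begin
    x                   ≡⟨ halves x ⟩
    Q.½ * (x + x)       ≡⟨ cong (λ z → Q.½ * (x + z)) eq ⟩
    Q.½ * (x + - x)     ≡⟨ cong (Q.½ *_) (Q.+-inverseʳ x) ⟩
    0ℚ                  ∎
    where
    halves : ∀ x → x ≡ Q.½ * (x + x)
    halves x = sym (trans (Q.*-distribˡ-+ Q.½ x x)
      (trans (sym (Q.*-distribʳ-+ x Q.½ Q.½)) (Q.*-identityˡ x)))

  det-∷-cong : ∀ n (r : Vector ℚ (suc n)) {R S : Fin n → Vector ℚ (suc n)} →
    (∀ i j → R i j ≡ S i j) → det (suc n) (r ∷ R) ≡ det (suc n) (r ∷ S)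
  det-∷-cong n r {R} {S} eq = det-cong (suc n) {r ∷ R} {r ∷ S} λ { zero j → refl ; (suc i) j → eq i j }

  -- If the repeated row comes second, exchanging the two equal rows gives `x ≡ - x`. Otherwise
  -- `R zero` is exchanged to the top, and every minor along it again has a repeated first row, so
  -- induction applies.
  det-repeat : ∀ n (R : Fin n → Vector ℚ (suc n)) (i : Fin n) → det (suc n) (R i ∷ R) ≡ 0ℚ
  det-repeat (suc n) R zero = trans (det-∷-cong (suc n) (R zero) split)
    (x≡-x⇒x≡0 _ (det-swap n (R zero) (R zero) (R ∘ suc)))
    where
    split : ∀ i j → R i j ≡ (R zero ∷ (R ∘ suc)) i j
    split zero    j = refl
    split (suc i) j = refl
  det-repeat (suc n) R (suc i) = begin
    det (suc (suc n)) (R (suc i) ∷ R)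
      ≡⟨ det-∷-cong (suc n) (R (suc i)) split ⟩
    det (suc (suc n)) (R (suc i) ∷ R zero ∷ (R ∘ suc))
      ≡⟨ det-swap n (R (suc i)) (R zero) (R ∘ suc) ⟩
    - det (suc (suc n)) (R zero ∷ R (suc i) ∷ (R ∘ suc))
      ≡⟨ cong -_ (sum-cong (suc (suc n)) λ j → trans
           (cong (λ z → sign (toℕ j) * (R zero j * z)) (minor-vanishes j))
           (times0 (sign (toℕ j)) (R zero j))) ⟩
    - sumFin (suc (suc n)) (λ _ → 0ℚ)
      ≡⟨ cong -_ (sum-0 (suc (suc n))) ⟩
    0ℚ ∎
    where
    split : ∀ i j → R i j ≡ (R zero ∷ (R ∘ suc)) i j
    split zero    j = refl
    split (suc i) j = refl

    times0 : ∀ a b → a * (b * 0ℚ) ≡ 0ℚ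
    times0 a b = trans (cong (a *_) (Q.*-zeroʳ b)) (Q.*-zeroʳ a)

    minor-vanishes : ∀ j →
      det (suc n) (minor (R zero ∷ R (suc i) ∷ (R ∘ suc)) j) ≡ 0ℚ
    minor-vanishes j = trans
      (det-cong (suc n) {minor (R zero ∷ R (suc i) ∷ (R ∘ suc)) j} {R′ i ∷ R′}
        λ { zero x → refl ; (suc k) x → refl })
      (det-repeat n R′ i)
      where
      R′ : Fin n → Vector ℚ (suc n)
      R′ k x = R (suc k) (punchIn j x)

  -- The cofactors along the first row do not involve that row, so the expansion is linear in it.
  det-combination : ∀ m n (c : Fin m → ℚ) (V : Fin m → Vector ℚ (suc n))
    (R : Fin n → Vector ℚ (suc n)) →
    det (suc n) ((λ j → sumFin m (λ k → c k * V k j)) ∷ R)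
      ≡ sumFin m (λ k → c k * det (suc n) (V k ∷ R))
  det-combination m n c V R = begin
    sumFin (suc n) (λ j → sign (toℕ j) * (sumFin m (λ k → c k * V k j) * cof j))
      ≡⟨ sum-cong (suc n) (λ j → distribute (sign (toℕ j)) (cof j) (λ k → V k j)) ⟩
    sumFin (suc n) (λ j → sumFin m (λ k → c k * (sign (toℕ j) * (V k j * cof j))))
      ≡⟨ sum-swap (suc n) m (λ j k → c k * (sign (toℕ j) * (V k j * cof j))) ⟩
    sumFin m (λ k → sumFin (suc n) (λ j → c k * (sign (toℕ j) * (V k j * cof j))))
      ≡⟨ sum-cong m (λ k → sum-*ˡ (suc n) (c k) (λ j → sign (toℕ j) * (V k j * cof j))) ⟩
    sumFin m (λ k → c k * det (suc n) (V k ∷ R)) ∎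
    where
    cof : Fin (suc n) → ℚ
    cof j = det n (λ r x → R r (punchIn j x))

    distribute : ∀ a b (v : Fin m → ℚ) →
      a * (sumFin m (λ k → c k * v k) * b) ≡ sumFin m (λ k → c k * (a * (v k * b)))
    distribute a b v = begin
      a * (sumFin m (λ k → c k * v k) * b)     ≡⟨ cong (a *_) (sum-*ʳ m b _) ⟨
      a * sumFin m (λ k → (c k * v k) * b)     ≡⟨ sum-*ˡ m a _ ⟨
      sumFin m (λ k → a * ((c k * v k) * b))   ≡⟨ sum-cong m (λ k → regroup a b (c k) (v k)) ⟩
      sumFin m (λ k → c k * (a * (v k * b)))   ∎
      where
      regroup : ∀ a b c v → a * ((c * v) * b) ≡ c * (a * (v * b))
      regroup = solve-∀ ℚ-ring

  tail : ∀ {n} → Matrix (suc n) → Matrix n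
  tail M i j = M (suc i) (suc j)

  Upper : ∀ n → Matrix n → Set
  Upper zero    A = ⊤
  Upper (suc n) A = (∀ i → A (suc i) zero ≡ 0ℚ) × Upper n (tail A)

  diagonalProduct : ∀ n → Matrix n → ℚ
  diagonalProduct zero    A = 1ℚ
  diagonalProduct (suc n) A = A zero zero * diagonalProduct n (tail A)

  _·_ : ∀ {n} → Matrix n → Matrix n → Matrix n
  _·_ {n} A M i j = sumFin n (λ k → A i k * M k j)

  _ᵀ : ∀ {n} → Matrix n → Matrix n
  (A ᵀ) i j = A j i

  -- Below the first row, `A · M` does not see `M zero`, because the first column of `A` vanishes
  -- there; by induction each minor is `d` times the minor of `M`. What remains is a determinant
  -- whose first row combines the rows of `M` and whose other rows are those of `M` itself: every
  -- term but that of `M zero` repeats a row.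
  det-upper-· : ∀ n (A M : Matrix n) → Upper n A → det n (A · M) ≡ diagonalProduct n A * det n M
  det-upper-· zero    A M _            = refl
  det-upper-· (suc n) A M (col , upper) = begin
    sumFin (suc n) (λ j → sign (toℕ j) * ((A · M) zero j * det n (minor (A · M) j)))
      ≡⟨ sum-cong (suc n) (λ j → trans
           (cong (λ z → sign (toℕ j) * ((A · M) zero j * z)) (minor-· j))
           (regroup (sign (toℕ j)) ((A · M) zero j) d (det n (minor M j)))) ⟩
    sumFin (suc n) (λ j → d * (sign (toℕ j) * ((A · M) zero j * det n (minor M j))))
      ≡⟨ sum-*ˡ (suc n) d (λ j → sign (toℕ j) * ((A · M) zero j * det n (minor M j))) ⟩
    d * det (suc n) ((A · M) zero ∷ (M ∘ suc))
      ≡⟨ cong (d *_) (det-combination (suc n) n (A zero) M (M ∘ suc)) ⟩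
    d * (A zero zero * det (suc n) (M zero ∷ (M ∘ suc))
        + sumFin n (λ k → A zero (suc k) * det (suc n) (M (suc k) ∷ (M ∘ suc))))
      ≡⟨ cong₂ (λ x y → d * (A zero zero * x + y))
           (det-cong (suc n) {M zero ∷ (M ∘ suc)} {M} λ { zero j → refl ; (suc i) j → refl })
           (trans (sum-cong n λ k → trans (cong (A zero (suc k) *_) (det-repeat n (M ∘ suc) k))
                                      (Q.*-zeroʳ (A zero (suc k))))
             (sum-0 n)) ⟩
    d * (A zero zero * det (suc n) M + 0ℚ)
      ≡⟨ finish d (A zero zero) (det (suc n) M) ⟩
    A zero zero * d * det (suc n) M ∎
    where
    d = diagonalProduct n (tail A)

    regroup : ∀ s x d y → s * (x * (d * y)) ≡ d * (s * (x * y))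
    regroup = solve-∀ ℚ-ring

    finish : ∀ d a x → d * (a * x + 0ℚ) ≡ a * d * x
    finish = solve-∀ ℚ-ring

    minor-· : ∀ j → det n (minor (A · M) j) ≡ d * det n (minor M j)
    minor-· j = trans
      (det-cong n λ i x → trans
        (cong (λ z → z * M zero (punchIn j x) + (tail A · minor M j) i x) (col i))
        (trans (cong (_+ (tail A · minor M j) i x) (Q.*-zeroˡ (M zero (punchIn j x)))) (Q.+-identityˡ _)))
      (det-upper-· n (tail A) (minor M j) upper)

  -- The first row of the transpose has only its diagonal entry, so the expansion collapses to one
  -- term.
  det-lower : ∀ n (A : Matrix n) → Upper n A → det n (A ᵀ) ≡ diagonalProduct n A
  det-lower zero    A _             = refl
  det-lower (suc n) A (col , upper) = begin
    1ℚ * (A zero zero * det n (tail A ᵀ)) + sumFin n (λ j → f (suc j) * (A (suc j) zero * g (suc j)))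
      ≡⟨ cong₂ _+_ (trans (Q.*-identityˡ _) (cong (A zero zero *_) (det-lower n (tail A) upper)))
           (trans (sum-cong n λ j → trans (cong (λ z → f (suc j) * (z * g (suc j))) (col j))
                                      (times0 (f (suc j)) (g (suc j))))
             (sum-0 n)) ⟩
    A zero zero * diagonalProduct n (tail A) + 0ℚ
      ≡⟨ Q.+-identityʳ _ ⟩
    A zero zero * diagonalProduct n (tail A) ∎
    where
    f g : Fin (suc n) → ℚ
    f j = sign (toℕ j)
    g j = det n (minor (A ᵀ) j)
    times0 : ∀ a b → a * (0ℚ * b) ≡ 0ℚ
    times0 a b = trans (cong (a *_) (Q.*-zeroˡ b)) (Q.*-zeroʳ a)

  gram : ∀ {n} → Matrix n → Matrix n
  gram B = B · (B ᵀ)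

  det-gram : ∀ n (B : Matrix n) → Upper n B →
    det n (gram B) ≡ diagonalProduct n B * diagonalProduct n B
  det-gram n B upper = trans (det-upper-· n B (B ᵀ) upper)
    (cong (diagonalProduct n B *_) (det-lower n B upper))

open Determinants

-- Positive definite Gram matrices from triangular bases.

module TriangularBases where
  open import Data.Nat.Base as ℕ using (ℕ; zero; suc)
  import Data.Nat.Properties as ℕ
  open import Data.Integer.Base as ℤ using (ℤ; +_; 0ℤ; 1ℤ; ∣_∣)
  import Data.Integer.Properties as ℤ
  import Data.Integer.Tactic.RingSolver as ℤ-Solver
  open import Data.Integer.Divisibility.Signed using (_∣_; divides)
  open import Data.Fin.Base using (Fin; zero; suc)
  open import Data.Rational.Base as Q using (ℚ; 0ℚ; 1ℚ; _+_; _*_; -_)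
  import Data.Rational.Properties as Q
  import Data.Rational.Unnormalised.Base as ℚᵘ
  import Data.Rational.Unnormalised.Properties as ℚᵘ
  open import Data.Product.Base using (_,_)
  open import Data.Sum.Base using (inj₁; inj₂)
  open import Data.Unit.Base using (tt)
  open import Data.Vec.Base using (Vec; []; _∷_; lookup)
  open import Function.Base using (_∘_)
  open import Relation.Binary.PropositionalEquality
  open import Relation.Nullary.Decidable using (yes; no)
  open import Tactic.RingSolver using (solve-∀)

  open ≡-Reasoning

  coordinates : ∀ {n} → Matrix n → (Fin n → ℚ) → Fin n → ℚ
  coordinates {n} B x k = sumFin n (λ i → x i * B i k)

  -- The Gram form at `x` is the squared length of the row vector `x B`, since
  -- `x (B Bᵀ) xᵀ = (x B) (x B)ᵀ`.
  quadForm-gram : ∀ n (B : Matrix n) (x : Fin n → ℚ) →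
    quadForm n (gram B) x ≡ sumFin n (λ k → coordinates B x k * coordinates B x k)
  quadForm-gram n B x = begin
    sumFin n (λ i → sumFin n (λ j → x i * (gram B i j * x j)))
      ≡⟨ sum-cong n (λ i → sum-cong n (expand i)) ⟩
    sumFin n (λ i → sumFin n (λ j → sumFin n (λ k → a i k * a j k)))
      ≡⟨ sum-cong n (λ i → sum-swap n n (λ j k → a i k * a j k)) ⟩
    sumFin n (λ i → sumFin n (λ k → sumFin n (λ j → a i k * a j k)))
      ≡⟨ sum-swap n n (λ i k → sumFin n (λ j → a i k * a j k)) ⟩
    sumFin n (λ k → sumFin n (λ i → sumFin n (λ j → a i k * a j k)))
      ≡⟨ sum-cong n (λ k → trans
           (sum-cong n (λ i → sum-*ˡ n (a i k) (λ j → a j k)))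
           (sum-*ʳ n (coordinates B x k) (λ i → a i k))) ⟩
    sumFin n (λ k → coordinates B x k * coordinates B x k) ∎
    where
    a : Fin n → Fin n → ℚ
    a i k = x i * B i k

    expand : ∀ i j → x i * (gram B i j * x j) ≡ sumFin n (λ k → a i k * a j k)
    expand i j = begin
      x i * (gram B i j * x j)
        ≡⟨ cong (x i *_) (sum-*ʳ n (x j) (λ k → B i k * B j k)) ⟨
      x i * sumFin n (λ k → (B i k * B j k) * x j)
        ≡⟨ sum-*ˡ n (x i) (λ k → (B i k * B j k) * x j) ⟨
      sumFin n (λ k → x i * ((B i k * B j k) * x j))
        ≡⟨ sum-cong n (λ k → regroup (x i) (B i k) (B j k) (x j)) ⟩
      sumFin n (λ k → a i k * a j k) ∎
      where
      regroup : ∀ x b c y → x * ((b * c) * y) ≡ (x * b) * (y * c)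
      regroup = solve-∀ ℚ-ring

  x*x≥0 : ∀ x → 0ℚ Q.≤ x * x
  x*x≥0 x with Q.≤-total 0ℚ x
  ... | inj₁ 0≤x = subst (Q._≤ x * x) (Q.*-zeroʳ x)
                     (Q.*-monoˡ-≤-nonNeg x {{Q.nonNegative 0≤x}} 0≤x)
  ... | inj₂ x≤0 = subst (Q._≤ x * x) (Q.*-zeroʳ x)
                     (Q.*-monoˡ-≤-nonPos x {{Q.nonPositive x≤0}} x≤0)

  x*y≡0⇒y≡0 : ∀ x y → x ≢ 0ℚ → x * y ≡ 0ℚ → y ≡ 0ℚ
  x*y≡0⇒y≡0 x y x≢0 xy≡0 = begin
    y                   ≡⟨ Q.*-identityˡ y ⟨
    1ℚ * y              ≡⟨ cong (_* y) (Q.*-inverseˡ x) ⟨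
    Q.1/ x * x * y      ≡⟨ Q.*-assoc (Q.1/ x) x y ⟩
    Q.1/ x * (x * y)    ≡⟨ cong (Q.1/ x *_) xy≡0 ⟩
    Q.1/ x * 0ℚ         ≡⟨ Q.*-zeroʳ (Q.1/ x) ⟩
    0ℚ                  ∎
    where instance _ = Q.≢-nonZero x≢0

  x*x≡0⇒x≡0 : ∀ x → x * x ≡ 0ℚ → x ≡ 0ℚ
  x*x≡0⇒x≡0 x eq with x Q.≟ 0ℚ
  ... | yes x≡0 = x≡0
  ... | no  x≢0 = x*y≡0⇒y≡0 x x x≢0 eq

  x≥0∧y≥0∧x+y≡0⇒x≡0 : ∀ x y → 0ℚ Q.≤ x → 0ℚ Q.≤ y → x + y ≡ 0ℚ → x ≡ 0ℚ
  x≥0∧y≥0∧x+y≡0⇒x≡0 x y 0≤x 0≤y eq = Q.≤-antisym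
    (subst₂ Q._≤_ (Q.+-identityʳ x) eq (Q.+-monoʳ-≤ x 0≤y)) 0≤x

  sum-squares≥0 : ∀ n (y : Fin n → ℚ) → 0ℚ Q.≤ sumFin n (λ k → y k * y k)
  sum-squares≥0 zero    y = Q.≤-refl
  sum-squares≥0 (suc n) y = Q.+-mono-≤ (x*x≥0 (y zero)) (sum-squares≥0 n (y ∘ suc))

  sum-squares≡0 : ∀ n (y : Fin n → ℚ) → sumFin n (λ k → y k * y k) ≡ 0ℚ → ∀ k → y k ≡ 0ℚ
  sum-squares≡0 (suc n) y eq zero    = x*x≡0⇒x≡0 (y zero)
    (x≥0∧y≥0∧x+y≡0⇒x≡0 (y zero * y zero) (sumFin n (λ k → y (suc k) * y (suc k)))
      (x*x≥0 (y zero)) (sum-squares≥0 n (y ∘ suc)) eq)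
  sum-squares≡0 (suc n) y eq (suc k) = sum-squares≡0 n (y ∘ suc)
    (x≥0∧y≥0∧x+y≡0⇒x≡0 (sumFin n (λ k → y (suc k) * y (suc k))) (y zero * y zero)
      (sum-squares≥0 n (y ∘ suc)) (x*x≥0 (y zero)) (trans (Q.+-comm _ (y zero * y zero)) eq)) k

  -- Forward substitution: the first coordinate of `x B` is `x zero * B zero zero`, which forces
  -- `x zero ≡ 0ℚ`; the other coordinates then only involve `tail B`.
  upper-injective : ∀ n (B : Matrix n) → Upper n B → (∀ i → B i i ≢ 0ℚ) →
    ∀ x → (∀ k → coordinates B x k ≡ 0ℚ) → ∀ i → x i ≡ 0ℚ
  upper-injective (suc n) B (col , upper) diag x eq = λ where
      zero    → x₀≡0
      (suc i) → upper-injective n (tail B) upper (diag ∘ suc) (x ∘ suc) tail-eq i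
    where
    x₀≡0 : x zero ≡ 0ℚ
    x₀≡0 = x*y≡0⇒y≡0 (B zero zero) (x zero) (diag zero) (begin
      B zero zero * x zero
        ≡⟨ Q.*-comm (B zero zero) (x zero) ⟩
      x zero * B zero zero
        ≡⟨ Q.+-identityʳ _ ⟨
      x zero * B zero zero + 0ℚ
        ≡⟨ cong (λ z → x zero * B zero zero + z) (trans
             (sum-cong n λ i → trans (cong (x (suc i) *_) (col i)) (Q.*-zeroʳ (x (suc i))))
             (sum-0 n)) ⟨
      coordinates B x zero
        ≡⟨ eq zero ⟩
      0ℚ ∎)

    tail-eq : ∀ k → coordinates (tail B) (x ∘ suc) k ≡ 0ℚ
    tail-eq k = begin
      s                               ≡⟨ Q.+-identityˡ s ⟨
      0ℚ + s                          ≡⟨ cong (_+ s) (Q.*-zeroˡ (B zero (suc k))) ⟨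
      0ℚ * B zero (suc k) + s         ≡⟨ cong (λ z → z * B zero (suc k) + s) x₀≡0 ⟨
      coordinates B x (suc k)         ≡⟨ eq (suc k) ⟩
      0ℚ                              ∎
      where s = coordinates (tail B) (x ∘ suc) k

  isGram-gram : ∀ n (B : Matrix n) → Upper n B → (∀ i → B i i ≢ 0ℚ) → IsGram n (gram B)
  isGram-gram n B upper diag = symmetric , positive
    where
    symmetric : Symmetric n (gram B)
    symmetric i j = sum-cong n (λ k → Q.*-comm (B i k) (B j k))

    positive : ∀ x → NonZeroVec n x → 0ℚ Q.< quadForm n (gram B) x
    positive x x≢0 = subst (0ℚ Q.<_) (sym (quadForm-gram n B x))
      (Q.≰⇒> λ ≤0 → x≢0 (upper-injective n B upper diag x
        (sum-squares≡0 n (coordinates B x)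
          (Q.≤-antisym ≤0 (sum-squares≥0 n (coordinates B x))))))

  -- The embedding of the integers in the rationals.

  ι : ℤ → ℚ
  ι z = z Q./ 1

  -- `ι z` is reduced to lowest terms through a gcd, which is opaque for a variable `z`. Sums,
  -- products and orders are therefore compared on unnormalised fractions with denominator 1.
  toℚᵘ-ι : ∀ z → Q.toℚᵘ (ι z) ℚᵘ.≃ ℚᵘ.mkℚᵘ z 0
  toℚᵘ-ι z = Q.toℚᵘ-fromℚᵘ (ℚᵘ.mkℚᵘ z 0)

  ι-+ : ∀ a b → ι (a ℤ.+ b) ≡ ι a + ι b
  ι-+ a b = Q.toℚᵘ-injective (ℚᵘ.≃-trans (toℚᵘ-ι (a ℤ.+ b)) (ℚᵘ.≃-trans
    (ℚᵘ.*≡* (numerators a b))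
    (ℚᵘ.≃-sym (ℚᵘ.≃-trans (Q.toℚᵘ-homo-+ (ι a) (ι b)) (ℚᵘ.+-cong (toℚᵘ-ι a) (toℚᵘ-ι b))))))
    where
    numerators : ∀ a b → (a ℤ.+ b) ℤ.* (1ℤ ℤ.* 1ℤ) ≡ (a ℤ.* 1ℤ ℤ.+ b ℤ.* 1ℤ) ℤ.* 1ℤ
    numerators = ℤ-Solver.solve-∀

  ι-* : ∀ a b → ι (a ℤ.* b) ≡ ι a * ι b
  ι-* a b = Q.toℚᵘ-injective (ℚᵘ.≃-trans (toℚᵘ-ι (a ℤ.* b)) (ℚᵘ.≃-trans
    (ℚᵘ.*≡* refl)
    (ℚᵘ.≃-sym (ℚᵘ.≃-trans (Q.toℚᵘ-homo-* (ι a) (ι b)) (ℚᵘ.*-cong (toℚᵘ-ι a) (toℚᵘ-ι b))))))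

  ι-mono-≤ : ∀ {a b} → a ℤ.≤ b → ι a Q.≤ ι b
  ι-mono-≤ {a} {b} a≤b = Q.toℚᵘ-cancel-≤
    (ℚᵘ.≤-respˡ-≃ (ℚᵘ.≃-sym (toℚᵘ-ι a)) (ℚᵘ.≤-respʳ-≃ (ℚᵘ.≃-sym (toℚᵘ-ι b))
      (ℚᵘ.*≤* (ℤ.*-monoʳ-≤-nonNeg 1ℤ a≤b))))

  ι-mono-< : ∀ {a b} → a ℤ.< b → ι a Q.< ι b
  ι-mono-< {a} {b} a<b = Q.toℚᵘ-cancel-<
    (ℚᵘ.<-respˡ-≃ (ℚᵘ.≃-sym (toℚᵘ-ι a)) (ℚᵘ.<-respʳ-≃ (ℚᵘ.≃-sym (toℚᵘ-ι b))
      (ℚᵘ.*<* (ℤ.*-monoʳ-<-pos 1ℤ a<b))))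

  ι≢0 : ∀ n .{{_ : ℕ.NonZero n}} → ι (+ n) ≢ 0ℚ
  ι≢0 (suc n) eq = Q.<-irrefl (sym eq) (ι-mono-< {0ℤ} {+ suc n} (ℤ.+<+ ℕ.z<s))

  -- Lattices defined by one congruence, and their triangular bases.

  normSq : ∀ {n} → Vec ℤ n → ℕ
  normSq []      = 0
  normSq (y ∷ v) = ∣ y ∣ ℕ.* ∣ y ∣ ℕ.+ normSq v

  sum-ι-squares : ∀ n (v : Vec ℤ n) →
    sumFin n (λ k → ι (lookup v k) * ι (lookup v k)) ≡ ι (+ normSq v)
  sum-ι-squares zero    []      = refl
  sum-ι-squares (suc n) (y ∷ v) = begin
    ι y * ι y + sumFin n (λ k → ι (lookup v k) * ι (lookup v k))
      ≡⟨ cong₂ _+_ (sym (ι-* y y)) (sum-ι-squares n v) ⟩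
    ι (y ℤ.* y) + ι (+ normSq v)
      ≡⟨ ι-+ (y ℤ.* y) (+ normSq v) ⟨
    ι (y ℤ.* y ℤ.+ + normSq v)
      ≡⟨ cong (λ z → ι (z ℤ.+ + normSq v)) (square-abs y) ⟨
    ι (+ normSq (y ∷ v)) ∎
    where
    square-abs : ∀ y → + (∣ y ∣ ℕ.* ∣ y ∣) ≡ y ℤ.* y
    square-abs (+ n)      = ℤ.pos-* n n
    square-abs ℤ.-[1+ n ] = refl

  lastEntry : ∀ {n} → ℤ → Fin (suc n) → ℤ
  lastEntry {zero}  c _       = c
  lastEntry {suc n} c zero    = 0ℤ
  lastEntry {suc n} c (suc k) = lastEntry c k

  addLast : ∀ {n} → ℤ → Vec ℤ (suc n) → Vec ℤ (suc n)
  addLast {zero}  c (y ∷ []) = (c ℤ.+ y) ∷ []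
  addLast {suc n} c (y ∷ v)  = y ∷ addLast c v

  lookup-addLast : ∀ {n} c (v : Vec ℤ (suc n)) k →
    lookup (addLast c v) k ≡ lastEntry c k ℤ.+ lookup v k
  lookup-addLast {zero}  c (y ∷ []) zero    = refl
  lookup-addLast {suc n} c (y ∷ v)  zero    = sym (ℤ.+-identityˡ y)
  lookup-addLast {suc n} c (y ∷ v)  (suc k) = lookup-addLast c v k

  addLast-0 : ∀ {n} (v : Vec ℤ (suc n)) → addLast 0ℤ v ≡ v
  addLast-0 {zero}  (y ∷ []) = cong (_∷ []) (ℤ.+-identityˡ y)
  addLast-0 {suc n} (y ∷ v)  = cong (y ∷_) (addLast-0 v)

  *-lastEntry : ∀ {n} a c (k : Fin (suc n)) → a ℤ.* lastEntry c k ≡ lastEntry (a ℤ.* c) k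
  *-lastEntry {zero}  a c zero    = refl
  *-lastEntry {suc n} a c zero    = ℤ.*-zeroʳ a
  *-lastEntry {suc n} a c (suc k) = *-lastEntry a c k

  -- The term is that of coding theory: `h` lists the coefficients of a parity check whose last
  -- coefficient is fixed at 1.
  syndrome : ∀ {n} → Vec ℤ n → Vec ℤ (suc n) → ℤ
  syndrome []      (w ∷ []) = w
  syndrome (a ∷ h) (y ∷ v)  = a ℤ.* y ℤ.+ syndrome h v

  syndrome-addLast : ∀ {n} (h : Vec ℤ n) c v → syndrome h (addLast c v) ≡ c ℤ.+ syndrome h v
  syndrome-addLast []      c (w ∷ [])  = refl
  syndrome-addLast (a ∷ h) c (y ∷ v) =
    trans (cong (λ z → a ℤ.* y ℤ.+ z) (syndrome-addLast h c v)) (swap (a ℤ.* y) c (syndrome h v))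
    where
    swap : ∀ x c z → x ℤ.+ (c ℤ.+ z) ≡ c ℤ.+ (x ℤ.+ z)
    swap = ℤ-Solver.solve-∀

  -- The rows are a basis of the lattice of all v with Q ∣ syndrome h v.
  basis : ∀ {n} → ℕ → Vec ℤ n → Fin (suc n) → Fin (suc n) → ℤ
  basis Q []      _       _       = + Q
  basis Q (a ∷ h) zero    zero    = 1ℤ
  basis Q (a ∷ h) zero    (suc k) = lastEntry (ℤ.- a) k
  basis Q (a ∷ h) (suc i) zero    = 0ℤ
  basis Q (a ∷ h) (suc i) (suc k) = basis Q h i k

  basisℚ : ∀ {n} → ℕ → Vec ℤ n → Matrix (suc n)
  basisℚ Q h i k = ι (basis Q h i k)

  upper-basis : ∀ {n} Q (h : Vec ℤ n) → Upper (suc n) (basisℚ Q h)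
  upper-basis Q []      = (λ ()) , tt
  upper-basis Q (a ∷ h) = (λ _ → refl) , upper-basis Q h

  basis-diagonal : ∀ {n} Q .{{_ : ℕ.NonZero Q}} (h : Vec ℤ n) i → basisℚ Q h i i ≢ 0ℚ
  basis-diagonal Q []      zero    = ι≢0 Q
  basis-diagonal Q (a ∷ h) zero    = λ ()
  basis-diagonal Q (a ∷ h) (suc i) = basis-diagonal Q h i

  diagonalProduct-basis : ∀ {n} Q (h : Vec ℤ n) →
    diagonalProduct (suc n) (basisℚ Q h) ≡ ι (+ Q)
  diagonalProduct-basis Q []      = Q.*-identityʳ (ι (+ Q))
  diagonalProduct-basis Q (a ∷ h) = trans (Q.*-identityˡ _) (diagonalProduct-basis Q h)

  -- The integer combination of the rows of `basis Q h` with coefficients `x`.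
  latticeVector : ∀ {n} → ℕ → Vec ℤ n → (Fin (suc n) → ℤ) → Vec ℤ (suc n)
  latticeVector Q []      x = (x zero ℤ.* + Q) ∷ []
  latticeVector Q (a ∷ h) x =
    x zero ∷ addLast (x zero ℤ.* ℤ.- a) (latticeVector Q h (x ∘ suc))

  coordinates-latticeVector : ∀ {n} Q (h : Vec ℤ n) (x : Fin (suc n) → ℤ) k →
    coordinates (basisℚ Q h) (intVec (suc n) x) k ≡ ι (lookup (latticeVector Q h x) k)
  coordinates-latticeVector Q [] x zero =
    trans (Q.+-identityʳ _) (sym (ι-* (x zero) (+ Q)))
  coordinates-latticeVector {suc n} Q (a ∷ h) x zero = begin
    ι (x zero) * 1ℚ + sumFin (suc n) (λ i → ι (x (suc i)) * 0ℚ)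
      ≡⟨ cong₂ _+_ (Q.*-identityʳ (ι (x zero))) (trans
           (sum-cong (suc n) (λ i → Q.*-zeroʳ (ι (x (suc i))))) (sum-0 (suc n))) ⟩
    ι (x zero) + 0ℚ
      ≡⟨ Q.+-identityʳ _ ⟩
    ι (x zero) ∎
  coordinates-latticeVector {suc n} Q (a ∷ h) x (suc k) = begin
    ι (x zero) * ι (lastEntry (ℤ.- a) k) + coordinates (basisℚ Q h) (intVec (suc n) (x ∘ suc)) k
      ≡⟨ cong₂ _+_ (sym (ι-* (x zero) (lastEntry (ℤ.- a) k)))
           (coordinates-latticeVector Q h (x ∘ suc) k) ⟩
    ι (x zero ℤ.* lastEntry (ℤ.- a) k) + ι (lookup v k)
      ≡⟨ ι-+ (x zero ℤ.* lastEntry (ℤ.- a) k) (lookup v k) ⟨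
    ι (x zero ℤ.* lastEntry (ℤ.- a) k ℤ.+ lookup v k)
      ≡⟨ cong (λ z → ι (z ℤ.+ lookup v k)) (*-lastEntry (x zero) (ℤ.- a) k) ⟩
    ι (lastEntry (x zero ℤ.* ℤ.- a) k ℤ.+ lookup v k)
      ≡⟨ cong ι (lookup-addLast (x zero ℤ.* ℤ.- a) v k) ⟨
    ι (lookup (addLast (x zero ℤ.* ℤ.- a) v) k) ∎
    where v = latticeVector Q h (x ∘ suc)

  quadForm-basis : ∀ {n} Q (h : Vec ℤ n) (x : Fin (suc n) → ℤ) →
    quadForm (suc n) (gram (basisℚ Q h)) (intVec (suc n) x) ≡ ι (+ normSq (latticeVector Q h x))
  quadForm-basis {n} Q h x = trans (quadForm-gram (suc n) (basisℚ Q h) (intVec (suc n) x))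
    (trans (sum-cong (suc n) λ k → cong (λ z → z * z) (coordinates-latticeVector Q h x k))
      (sum-ι-squares (suc n) (latticeVector Q h x)))

  -- A row with coefficient `a` contributes `a * x zero` through its leading 1 and the opposite
  -- amount through its last entry. Only the multiple of `Q` from the last row survives.
  syndrome-latticeVector : ∀ {n} Q (h : Vec ℤ n) x → + Q ∣ syndrome h (latticeVector Q h x)
  syndrome-latticeVector Q []      x = divides (x zero) refl
  syndrome-latticeVector Q (a ∷ h) x = subst (+ Q ∣_) (sym (begin
    a ℤ.* x zero ℤ.+ syndrome h (addLast (x zero ℤ.* ℤ.- a) v)
      ≡⟨ cong (λ z → a ℤ.* x zero ℤ.+ z) (syndrome-addLast h (x zero ℤ.* ℤ.- a) v) ⟩
    a ℤ.* x zero ℤ.+ (x zero ℤ.* ℤ.- a ℤ.+ syndrome h v)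
      ≡⟨ cancel a (x zero) (syndrome h v) ⟩
    syndrome h v ∎)) (syndrome-latticeVector Q h (x ∘ suc))
    where
    v = latticeVector Q h (x ∘ suc)
    cancel : ∀ a x c → a ℤ.* x ℤ.+ (x ℤ.* ℤ.- a ℤ.+ c) ≡ c
    cancel = ℤ-Solver.solve-∀

open TriangularBases

-- Counting the integer vectors in a ball.

module GreedyChoice where
  open import Data.Nat.Base as ℕ using (ℕ; zero; suc; _+_; _*_; _^_; _∸_; _≤_; _<_; z≤n; NonZero)
  import Data.Nat.Properties as ℕ
  import Data.Nat.Divisibility as ℕ
  open import Data.Nat.Coprimality using (Coprime; coprime-divisor)
  open import Data.Nat.ListAction using (sum)
  open import Data.Nat.Tactic.RingSolver using (solve-∀)
  open import Data.Integer.Base as ℤ using (ℤ; +_; -[1+_]; 0ℤ; 1ℤ; ∣_∣)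
  import Data.Integer.Properties as ℤ
  import Data.Integer.Tactic.RingSolver as ℤ-Solver
  open import Data.Integer.Divisibility.Signed as ∣ using (_∣_; divides; _∣?_)
  open import Data.Fin.Base as Fin using (Fin; zero; suc; toℕ)
  import Data.Fin.Properties as Fin
  open import Data.List.Base as List using (List; []; _∷_; _++_; map; concatMap; length; upTo)
  open import Data.List.Properties using (length-++; length-map)
  open import Data.List.Membership.Propositional using (_∈_; lose)
  open import Data.List.Membership.Propositional.Properties
  open import Data.List.Relation.Unary.Any as Any using (Any; here; any?)
  open import Data.List.Relation.Unary.Any.Properties using (lookup-index)
  open import Data.Product.Base using (_×_; _,_; proj₁; proj₂; ∃)
  open import Data.Vec.Base using (Vec; []; _∷_)
  open import Function.Base using (_∘_)
  open import Relation.Binary.PropositionalEquality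
  open import Relation.Nullary.Negation using (¬_; contradiction)
  open import Relation.Nullary.Decidable using (yes; no; ¬?; _×-dec_)
  open import Relation.Unary using (Decidable)

  -- Runs from `- q` to `q - 1`, because `-[1+ n ]` stands for `- (n + 1)`. The list is used for
  -- upper bounds, so it suffices that all `x` with `∣ x ∣ < q` occur.
  box : ℕ → List ℤ
  box q = map +_ (upTo q) ++ map -[1+_] (upTo q)

  ∈-box : ∀ {q} x → ∣ x ∣ < q → x ∈ box q
  ∈-box     (+ n)    n<q = ∈-++⁺ˡ (∈-map⁺ +_ (∈-upTo⁺ n<q))
  ∈-box {q} -[1+ n ] n<q =
    ∈-++⁺ʳ (map +_ (upTo q)) (∈-map⁺ -[1+_] (∈-upTo⁺ (ℕ.<-trans (ℕ.n<1+n n) n<q)))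

  square : ℤ → ℕ
  square x = ∣ x ∣ * ∣ x ∣

  ball : ℕ → ∀ n → ℕ → List (Vec ℤ n)
  slice : ℕ → ∀ n → ℕ → ℤ → List (Vec ℤ (suc n))

  ball q zero    M = [] ∷ []
  ball q (suc n) M = concatMap (slice q n M) (box q)

  slice q n M x with square x ℕ.≤? M
  ... | yes _ = map (x ∷_) (ball q n (M ∸ square x))
  ... | no  _ = []

  square-cancel-< : ∀ m n → m * m < n * n → m < n
  square-cancel-< m n m²<n² = ℕ.≰⇒> λ n≤m → ℕ.<⇒≱ m²<n² (ℕ.*-mono-≤ n≤m n≤m)

  -- `M < q * q` forces every coordinate below `q` in absolute value, so a search through `box q`
  -- misses nothing.
  ∈-ball : ∀ q {n} (v : Vec ℤ n) {M} → M < q * q → normSq v ≤ M → v ∈ ball q n M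
  ∈-ball q []      M<q² _   = here refl
  ∈-ball q (x ∷ v) {M} M<q² v≤M =
    ∈-concatMap⁺ (slice q _ M) (lose x∈box ∈-slice)
    where
    x²≤M : square x ≤ M
    x²≤M = ℕ.m+n≤o⇒m≤o (square x) v≤M

    x∈box : x ∈ box q
    x∈box = ∈-box x (square-cancel-< ∣ x ∣ q (ℕ.≤-<-trans x²≤M M<q²))

    ∈-slice : x ∷ v ∈ slice q _ M x
    ∈-slice with square x ℕ.≤? M
    ... | yes _   = ∈-map⁺ (x ∷_) (∈-ball q v (ℕ.≤-<-trans (ℕ.m∸n≤m M (square x)) M<q²)
                      (ℕ.m+n≤o⇒m≤o∸n (normSq v) (subst (_≤ M) (ℕ.+-comm (square x) (normSq v)) v≤M)))
    ... | no ≰M = contradiction x²≤M ≰M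

  -- The theta series Σ 4^(-x²), cut off to `box q` and scaled by `4 ^ (q * q)` to stay in ℕ. The
  -- subtraction never truncates, as `∣ x ∣ ≤ q` in the box.
  thetaSum : ℕ → ℕ
  thetaSum q = sum (map (λ x → 4 ^ (q * q ∸ square x)) (box q))

  -- Chernoff's bound: a vector v of norm at most M is counted with weight 4 ^ (M ∸ normSq v),
  -- and these weights factor over the coordinates. The ratio T / D bounds the
  -- one-dimensional sum Σ 4^(-x²).
  length-ball : ∀ q D T → thetaSum q * D ≤ T * 4 ^ (q * q) →
    ∀ n M → length (ball q n M) * D ^ n ≤ T ^ n * 4 ^ M
  length-ball q D T θ≤ zero    M = ℕ.≤-trans (ℕ.m^n>0 4 M) (ℕ.≤-reflexive (sym (ℕ.+-identityʳ _)))
  length-ball q D T θ≤ (suc n) M = ℕ.*-cancelʳ-≤ _ _ (4 ^ (q * q)) {{ℕ.m^n≢0 4 (q * q)}} (begin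
    length (ball q (suc n) M) * (D * D ^ n) * 4 ^ E
      ≡⟨ regroup₁ (length (ball q (suc n) M)) D (D ^ n) (4 ^ E) ⟩
    length (ball q (suc n) M) * (D ^ n * 4 ^ E) * D
      ≤⟨ ℕ.*-monoˡ-≤ D (length-slices (box q)) ⟩
    T ^ n * 4 ^ M * thetaSum q * D
      ≡⟨ ℕ.*-assoc (T ^ n * 4 ^ M) (thetaSum q) D ⟩
    T ^ n * 4 ^ M * (thetaSum q * D)
      ≤⟨ ℕ.*-monoʳ-≤ (T ^ n * 4 ^ M) θ≤ ⟩
    T ^ n * 4 ^ M * (T * 4 ^ E)
      ≡⟨ regroup₂ (T ^ n) (4 ^ M) T (4 ^ E) ⟩
    T * T ^ n * 4 ^ M * 4 ^ E ∎)
    where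
    open ℕ.≤-Reasoning
    E = q * q

    regroup₁ : ∀ l d e f → l * (d * e) * f ≡ l * (e * f) * d
    regroup₁ = solve-∀

    regroup₂ : ∀ a b t f → a * b * (t * f) ≡ t * a * b * f
    regroup₂ = solve-∀

    length-slice : ∀ x → length (slice q n M x) * (D ^ n * 4 ^ E) ≤ T ^ n * 4 ^ M * 4 ^ (E ∸ square x)
    length-slice x with square x ℕ.≤? M
    ... | no  _    = z≤n
    ... | yes x²≤M = begin
      length (map (x ∷_) B) * (D ^ n * 4 ^ E)
        ≡⟨ cong (_* (D ^ n * 4 ^ E)) (length-map (x ∷_) B) ⟩
      length B * (D ^ n * 4 ^ E)
        ≡⟨ ℕ.*-assoc (length B) (D ^ n) (4 ^ E) ⟨
      length B * D ^ n * 4 ^ E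
        ≤⟨ ℕ.*-monoˡ-≤ (4 ^ E) (length-ball q D T θ≤ n (M ∸ square x)) ⟩
      T ^ n * 4 ^ (M ∸ square x) * 4 ^ E
        ≡⟨ ℕ.*-assoc (T ^ n) (4 ^ (M ∸ square x)) (4 ^ E) ⟩
      T ^ n * (4 ^ (M ∸ square x) * 4 ^ E)
        ≡⟨ cong (T ^ n *_) (ℕ.^-distribˡ-+-* 4 (M ∸ square x) E) ⟨
      T ^ n * 4 ^ (M ∸ square x + E)
        ≤⟨ ℕ.*-monoʳ-≤ (T ^ n) (ℕ.^-monoʳ-≤ 4 exponents) ⟩
      T ^ n * 4 ^ (M + (E ∸ square x))
        ≡⟨ cong (T ^ n *_) (ℕ.^-distribˡ-+-* 4 M (E ∸ square x)) ⟩
      T ^ n * (4 ^ M * 4 ^ (E ∸ square x))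
        ≡⟨ ℕ.*-assoc (T ^ n) (4 ^ M) (4 ^ (E ∸ square x)) ⟨
      T ^ n * 4 ^ M * 4 ^ (E ∸ square x) ∎
      where
      B = ball q n (M ∸ square x)
      exponents : M ∸ square x + E ≤ M + (E ∸ square x)
      exponents = begin
        M ∸ square x + E                               ≤⟨ ℕ.+-monoʳ-≤ (M ∸ square x) (ℕ.m≤n+m∸n E (square x)) ⟩
        M ∸ square x + (square x + (E ∸ square x))     ≡⟨ ℕ.+-assoc (M ∸ square x) (square x) (E ∸ square x) ⟨
        M ∸ square x + square x + (E ∸ square x)       ≡⟨ cong (_+ (E ∸ square x)) (ℕ.m∸n+n≡m x²≤M) ⟩
        M + (E ∸ square x)                             ∎

    length-slices : ∀ xs → length (concatMap (slice q n M) xs) * (D ^ n * 4 ^ E)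
      ≤ T ^ n * 4 ^ M * sum (map (λ x → 4 ^ (E ∸ square x)) xs)
    length-slices []       = z≤n
    length-slices (x ∷ xs) = begin
      length (slice q n M x ++ concatMap (slice q n M) xs) * c
        ≡⟨ cong (_* c) (length-++ (slice q n M x)) ⟩
      (length (slice q n M x) + length (concatMap (slice q n M) xs)) * c
        ≡⟨ ℕ.*-distribʳ-+ c (length (slice q n M x)) (length (concatMap (slice q n M) xs)) ⟩
      length (slice q n M x) * c + length (concatMap (slice q n M) xs) * c
        ≤⟨ ℕ.+-mono-≤ (length-slice x) (length-slices xs) ⟩
      d * 4 ^ (E ∸ square x) + d * sum (map (λ x → 4 ^ (E ∸ square x)) xs)
        ≡⟨ ℕ.*-distribˡ-+ d (4 ^ (E ∸ square x)) _ ⟨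
      d * (4 ^ (E ∸ square x) + sum (map (λ x → 4 ^ (E ∸ square x)) xs)) ∎
      where
      c = D ^ n * 4 ^ E
      d = T ^ n * 4 ^ M

  -- Greedy choice of the coefficients of the congruence.

  NoShortVector : ∀ {n} → ℕ → ℕ → Vec ℤ n → Set
  NoShortVector q Q h = ∀ v → + Q ∣ syndrome h v → normSq v < q * q → normSq v ≡ 0

  -- Subtracting the two congruences gives `Q ∣ y * (j - i)`. As `y` is invertible modulo `Q`, this
  -- yields `Q ∣ j - i`, impossible for `0 < j - i < Q`.
  coefficient-unique : ∀ {Q i j} y s → Coprime Q ∣ y ∣ → i < j → j < Q →
    + Q ∣ + i ℤ.* y ℤ.+ s → ¬ (+ Q ∣ + j ℤ.* y ℤ.+ s)
  coefficient-unique {Q} {i} {j} y s coprime i<j j<Q Q∣i Q∣j =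
    ℕ.<⇒≱ (ℕ.≤-<-trans (ℕ.m∸n≤m j i) j<Q)
      (ℕ.∣⇒≤ {{ℕ.>-nonZero (ℕ.m<n⇒0<n∸m i<j)}} (coprime-divisor coprime Q∣y*[j∸i]))
    where
    difference : ∀ i j y s → j ℤ.* y ℤ.+ s ℤ.- (i ℤ.* y ℤ.+ s) ≡ y ℤ.* (j ℤ.- i)
    difference = ℤ-Solver.solve-∀

    Q∣y*[j∸i] : Q ℕ.∣ ∣ y ∣ * (j ∸ i)
    Q∣y*[j∸i] = subst (Q ℕ.∣_)
      (trans (cong ∣_∣ (trans (difference (+ i) (+ j) y s)
                    (cong (y ℤ.*_) (trans (ℤ.m-n≡m⊖n j i) (ℤ.⊖-≥ (ℕ.<⇒≤ i<j))))))
        (ℤ.abs-* y (+ (j ∸ i))))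
      (∣.∣⇒∣ᵤ (∣.∣m∣n⇒∣m-n Q∣j Q∣i))

  -- Pigeonhole: if each of the `Q` residues were hit by a listed vector, two residues would share
  -- one, against `hit-unique`. For the residue left free, a short lattice vector has new coordinate
  -- 0, and its remaining part is covered by `short`.
  extend : ∀ {n} q Q (h : Vec ℤ n) → (∀ y → 0 < y → y < q → Coprime Q y) →
    length (ball q (suc (suc n)) (q * q ∸ 1)) < Q →
    NoShortVector q Q h → ∃ λ a → NoShortVector q Q (a ∷ h)
  extend {n} q Q h coprime few short = + toℕ a , short′
    where
    -- The closed ball of squared radius `q * q - 1` holds exactly the integer vectors of norm less
    -- than `q * q`.
    points = ball q (suc (suc n)) (q * q ∸ 1)

    Hit : Fin Q → Vec ℤ (suc (suc n)) → Set
    Hit a (y ∷ v) = y ≢ 0ℤ × ∣ y ∣ < q × + Q ∣ + toℕ a ℤ.* y ℤ.+ syndrome h v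

    hit? : ∀ a → Decidable (Hit a)
    hit? a (y ∷ v) = ¬? (y ℤ.≟ 0ℤ) ×-dec (∣ y ∣ ℕ.<? q ×-dec (+ Q ∣? _))

    hit-unique : ∀ {a b} → a Fin.< b → ∀ v → Hit a v → ¬ Hit b v
    hit-unique {b = b} a<b (y ∷ v) (y≢0 , y<q , a-hit) (_ , _ , b-hit) =
      coefficient-unique y (syndrome h v)
        (coprime ∣ y ∣ (ℕ.n≢0⇒n>0 (y≢0 ∘ ℤ.∣i∣≡0⇒i≡0)) y<q) a<b (Fin.toℕ<n b) a-hit b-hit

    not-all-hit : ¬ (∀ a → Any (Hit a) points)
    not-all-hit all with i , j , i<j , same ← Fin.pigeonhole few (λ a → Any.index (all a)) =
      hit-unique i<j (List.lookup points (Any.index (all j)))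
        (subst (Hit i ∘ List.lookup points) same (lookup-index (all i)))
        (lookup-index (all j))

    good : ∃ λ a → ¬ Any (Hit a) points
    good = Fin.¬∀⟶∃¬ Q (λ a → Any (Hit a) points) (λ a → any? (hit? a) points) not-all-hit

    a = proj₁ good

    short′ : NoShortVector q Q (+ toℕ a ∷ h)
    short′ (y ∷ v) Q∣ v<q² with y ℤ.≟ 0ℤ
    ... | yes refl = short v (subst (+ Q ∣_)
            (trans (cong (ℤ._+ syndrome h v) (ℤ.*-zeroʳ (+ toℕ a))) (ℤ.+-identityˡ _)) Q∣) v<q²
    ... | no  y≢0  = contradiction
            (lose (∈-ball q (y ∷ v) (ℕ.≤-reflexive (ℕ.suc-pred (q * q) {{ℕ.>-nonZero 0<q²}}))
                    (ℕ.<⇒≤pred v<q²))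
              (y≢0 , square-cancel-< ∣ y ∣ q (ℕ.m+n≤o⇒m≤o (suc (square y)) v<q²) , Q∣))
            (proj₂ good)
      where
      0<q² : 0 < q * q
      0<q² = ℕ.≤-<-trans z≤n v<q²

  ∣-small⇒≡0 : ∀ m i → + m ∣ i → ∣ i ∣ < m → i ≡ 0ℤ
  ∣-small⇒≡0 m i m∣i i<m with i ℤ.≟ 0ℤ
  ... | yes i≡0 = i≡0
  ... | no  i≢0 = contradiction
    (ℕ.∣⇒≤ {{ℕ.≢-nonZero (i≢0 ∘ ℤ.∣i∣≡0⇒i≡0)}} (∣.∣⇒∣ᵤ m∣i)) (ℕ.<⇒≱ i<m)

  -- The plane lattice P y + w ≡ 0 (mod q P) is spanned by (q , 0) and (1 , - P).
  base-noShortVector : ∀ q P .{{_ : NonZero P}} → q ≤ P → NoShortVector q (q * P) (+ P ∷ [])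
  base-noShortVector q P q≤P (y ∷ w ∷ []) qP∣ short =
    cong₂ (λ y w → square y + (square w + 0)) y≡0 w≡0
    where
    w≡0 : w ≡ 0ℤ
    w≡0 = ∣-small⇒≡0 P w
      (∣.∣m+n∣m⇒∣n (∣.∣-trans (divides (+ q) (ℤ.pos-* q P)) qP∣) (∣.∣m⇒∣m*n y (∣.∣-refl {+ P})))
      (ℕ.<-≤-trans (square-cancel-< ∣ w ∣ q (ℕ.≤-<-trans
        (ℕ.≤-trans (ℕ.≤-reflexive (sym (ℕ.+-identityʳ (square w)))) (ℕ.m≤n+m _ (square y))) short)) q≤P)

    y≡0 : y ≡ 0ℤ
    y≡0 = ∣-small⇒≡0 q y
      (∣.*-cancelˡ-∣ (+ P) (subst₂ _∣_ (trans (ℤ.pos-* q P) (ℤ.*-comm (+ q) (+ P)))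
        (trans (cong (λ z → + P ℤ.* y ℤ.+ z) w≡0) (ℤ.+-identityʳ _)) qP∣))
      (square-cancel-< ∣ y ∣ q (ℕ.m+n≤o⇒m≤o (suc (square y)) short))

  noShortVector-exists : ∀ q P D T .{{_ : NonZero P}} → q ≤ P →
    (∀ y → 0 < y → y < q → Coprime (q * P) y) →
    thetaSum q * D ≤ T * 4 ^ (q * q) → D ≤ T →
    ∀ n → T ^ (2 + n) * 4 ^ (q * q ∸ 1) < q * P * D ^ (2 + n) →
    ∃ λ (h : Vec ℤ (suc n)) → NoShortVector q (q * P) h
      × ∃ λ x → normSq (latticeVector (q * P) h x) ≡ q * q
  noShortVector-exists q P D T q≤P coprime θ≤ D≤T zero    _   =
    + P ∷ [] , base-noShortVector q P q≤P , x , norm-x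
    where
    -- `q` times the row `(1 , - P)` plus the row `(0 , q P)` is `(q , 0)`.
    x : Fin 2 → ℤ
    x zero    = + q
    x (suc _) = 1ℤ

    last≡0 : + q ℤ.* ℤ.- + P ℤ.+ 1ℤ ℤ.* + (q * P) ≡ 0ℤ
    last≡0 = trans (cong (λ z → + q ℤ.* ℤ.- + P ℤ.+ 1ℤ ℤ.* z) (ℤ.pos-* q P)) (cancel (+ q) (+ P))
      where
      cancel : ∀ a b → a ℤ.* ℤ.- b ℤ.+ 1ℤ ℤ.* (a ℤ.* b) ≡ 0ℤ
      cancel = ℤ-Solver.solve-∀

    norm-x : normSq (latticeVector (q * P) (+ P ∷ []) x) ≡ q * q
    norm-x = trans (cong (λ z → q * q + (square z + 0)) last≡0) (ℕ.+-identityʳ (q * q))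
  noShortVector-exists q P D T q≤P coprime θ≤ D≤T (suc n) few =
    let h , short , x , norm-x = noShortVector-exists q P D T q≤P coprime θ≤ D≤T n few′
        a , short′ = extend q (q * P) h coprime few″ short
    in a ∷ h , short′ , pad x ,
       trans (cong normSq (addLast-0 (latticeVector (q * P) h x))) norm-x
    where
    open ℕ.≤-Reasoning
    c = 4 ^ (q * q ∸ 1)

    -- Since `T / D` is at least 1, the bound in the larger dimension implies the one below it.
    few′ : T ^ (2 + n) * c < q * P * D ^ (2 + n)
    few′ = ℕ.*-cancelˡ-< D _ _ (begin-strict
      D * (T ^ (2 + n) * c)         ≤⟨ ℕ.*-monoˡ-≤ (T ^ (2 + n) * c) D≤T ⟩
      T * (T ^ (2 + n) * c)         ≡⟨ ℕ.*-assoc T (T ^ (2 + n)) c ⟨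
      T ^ (3 + n) * c               <⟨ few ⟩
      q * P * (D * D ^ (2 + n))     ≡⟨ regroup (q * P) D (D ^ (2 + n)) ⟩
      D * (q * P * D ^ (2 + n))     ∎)
      where
      regroup : ∀ a d e → a * (d * e) ≡ d * (a * e)
      regroup = solve-∀

    -- `length-ball` and `few` compare the two sides after multiplication by `D ^ (3 + n)`, which is
    -- cancelled.
    few″ : length (ball q (3 + n) (q * q ∸ 1)) < q * P
    few″ = ℕ.*-cancelʳ-< (D ^ (3 + n)) _ _
      (ℕ.≤-<-trans (length-ball q D T θ≤ (3 + n) (q * q ∸ 1)) few)

    pad : (Fin (2 + n) → ℤ) → Fin (3 + n) → ℤ
    pad x zero    = 0ℤ
    pad x (suc i) = x i

open GreedyChoice

open import Data.Nat using (ℕ; _+_; _*_; _∸_; _≤_; _%_; _/_)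
open import Data.Nat.Base using (_^_; _<_; zero; suc; z≤n; s≤s; NonZero)
import Data.Nat.Base as ℕ
import Data.Nat.Properties as ℕ
import Data.Nat.Divisibility as ℕ
open import Data.Nat.Primality using (Prime; prime?; prime⇒nonZero)
open import Data.Nat.Coprimality using (Coprime; coprime-divisor; prime⇒coprime)
open import Data.Integer using (+_; 1ℤ)
import Data.Integer.Base as ℤ
import Data.Integer.Properties as ℤ
open import Data.Rational using (ℚ; 0ℚ)
import Data.Rational.Base as Q
import Data.Rational.Properties as Q
import Data.Rational.Unnormalised.Base as ℚᵘ
import Data.Rational.Unnormalised.Properties as ℚᵘ
open import Data.Product using (Σ; _×_; _,_; proj₁; proj₂)
open import Function.Base using (_∘_)
open import Relation.Binary.PropositionalEquality
  using (_≡_; refl; sym; trans; cong; cong₂; subst; subst₂)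
open import Relation.Nullary.Decidable using (toWitness; _×-dec_)
open import Relation.Unary using (Decidable)
open import Tactic.RingSolver using (solve-∀)

-- Lattices with prescribed minimal norm and determinant.

coprime-* : ∀ {m n k} → Coprime m k → Coprime n k → Coprime (m * n) k
coprime-* m⊥k n⊥k (d∣mn , d∣k) = n⊥k
  ( coprime-divisor (λ (e∣d , e∣m) → m⊥k (e∣m , ℕ.∣-trans e∣d d∣k)) d∣mn
  , d∣k )

coprime-^ : ∀ {m k} n → Coprime m k → Coprime (m ^ n) k
coprime-^ zero    m⊥k = ℕ.∣1⇒≡1 ∘ proj₁
coprime-^ (suc n) m⊥k = coprime-* m⊥k (coprime-^ n m⊥k)

-- The modulus is a power of the prime `q`, hence coprime to every `y` with `0 < y < q`. The
-- exponent `2 + j` makes it `q * P` with `P = q ^ (1 + j) ≥ q`, as the plane lattice requires.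
denseLattice : ∀ q j D T → Prime q →
  thetaSum q * D ≤ T * 4 ^ (q * q) → D ≤ T →
  ∀ n → 2 ≤ n → T ^ n * 4 ^ (q * q ∸ 1) < q ^ (2 + j) * D ^ n →
  Σ (Matrix n) λ G → IsGram n G × IsMinNormSq n G (ι (+ (q * q)))
    × det n G ≡ ι (+ (q ^ (2 + j) * q ^ (2 + j)))
denseLattice q j D T q-prime θ≤ D≤T (suc (suc n)) (s≤s (s≤s z≤n)) few =
  G , isGram , (minimal , x , x≢0 , norm-x) , det-G
  where
  instance
    q≢0 : NonZero q
    q≢0 = prime⇒nonZero q-prime
    P≢0 : NonZero (q ^ (1 + j))
    P≢0 = ℕ.m^n≢0 q (1 + j)
    Q≢0 : NonZero (q ^ (2 + j))
    Q≢0 = ℕ.m^n≢0 q (2 + j)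

  Q = q ^ (2 + j)

  exists = noShortVector-exists q (q ^ (1 + j)) D T
    (ℕ.m≤m*n q (q ^ j) {{ℕ.m^n≢0 q j}})
    (λ y 0<y y<q → coprime-^ (2 + j) (prime⇒coprime q-prime {{ℕ.>-nonZero 0<y}} y<q))
    θ≤ D≤T n few

  h = proj₁ exists
  short = proj₁ (proj₂ exists)
  x = proj₁ (proj₂ (proj₂ exists))

  B = basisℚ Q h
  G = gram B

  isGram : IsGram (2 + n) G
  isGram = isGram-gram (2 + n) B (upper-basis Q h) (basis-diagonal Q h)

  norm-x : quadForm (2 + n) G (intVec (2 + n) x) ≡ ι (+ (q * q))
  norm-x = trans (quadForm-basis Q h x) (cong (ι ∘ +_) (proj₂ (proj₂ (proj₂ exists))))

  x≢0 : NonZeroVec (2 + n) (intVec (2 + n) x)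
  x≢0 x≡0 = ι≢0 (q * q) {{ℕ.m*n≢0 q q}} (trans (sym norm-x)
    (trans (sum-cong (2 + n) λ i → trans
             (sum-cong (2 + n) λ k → trans
               (cong (λ z → z Q.* (G i k Q.* intVec (2 + n) x k)) (x≡0 i))
               (Q.*-zeroˡ (G i k Q.* intVec (2 + n) x k)))
             (sum-0 (2 + n)))
      (sum-0 (2 + n))))

  minimal : ∀ y → NonZeroVec (2 + n) (intVec (2 + n) y) →
    ι (+ (q * q)) Q.≤ quadForm (2 + n) G (intVec (2 + n) y)
  -- A norm below `q * q` would be 0 by `short`, against positive definiteness.
  minimal y y≢0 = subst (ι (+ (q * q)) Q.≤_) (sym (quadForm-basis Q h y))
    (ι-mono-≤ {+ (q * q)} {+ normSq v} (ℤ.+≤+ (ℕ.≮⇒≥ λ v<q² →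
      Q.<-irrefl refl (subst (0ℚ Q.<_)
        (trans (quadForm-basis Q h y)
          (cong (ι ∘ +_) (short v (syndrome-latticeVector Q h y) v<q²)))
        (proj₂ isGram (intVec (2 + n) y) y≢0)))))
    where v = latticeVector Q h y

  det-G : det (2 + n) G ≡ ι (+ (Q * Q))
  det-G = trans (det-gram (2 + n) B (upper-basis Q h))
    (trans (cong (λ d → d Q.* d) (diagonalProduct-basis Q h))
      (trans (sym (ι-* (+ Q) (+ Q))) (cong ι (sym (ℤ.pos-* Q Q)))))

-- Reduction of the density inequality to natural numbers.

^ℚ-distrib-* : ∀ x y n → (x Q.* y) ^ℚ n ≡ (x ^ℚ n) Q.* (y ^ℚ n)
^ℚ-distrib-* x y zero    = refl
^ℚ-distrib-* x y (suc n) = trans (cong (x Q.* y Q.*_) (^ℚ-distrib-* x y n))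
  (interchange x y (x ^ℚ n) (y ^ℚ n))
  where
  interchange : ∀ a b c d → a Q.* b Q.* (c Q.* d) ≡ a Q.* c Q.* (b Q.* d)
  interchange = solve-∀ ℚ-ring

^ℚ-+ : ∀ x m n → x ^ℚ (m + n) ≡ (x ^ℚ m) Q.* (x ^ℚ n)
^ℚ-+ x zero    n = sym (Q.*-identityˡ (x ^ℚ n))
^ℚ-+ x (suc m) n = trans (cong (x Q.*_) (^ℚ-+ x m n)) (sym (Q.*-assoc x (x ^ℚ m) (x ^ℚ n)))

ι-ℕ-* : ∀ a b → ι (+ (a * b)) ≡ ι (+ a) Q.* ι (+ b)
ι-ℕ-* a b = trans (cong ι (ℤ.pos-* a b)) (ι-* (+ a) (+ b))

ι-^ : ∀ a n → ι (+ (a ^ n)) ≡ ι (+ a) ^ℚ n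
ι-^ a zero    = refl
ι-^ a (suc n) = trans (ι-ℕ-* a (a ^ n)) (cong (ι (+ a) Q.*_) (ι-^ a n))

/-*-cancel : ∀ z d → (z Q./ suc d) Q.* ι (+ suc d) ≡ ι z
/-*-cancel z d = Q.toℚᵘ-injective (ℚᵘ.≃-trans (Q.toℚᵘ-homo-* (z Q./ suc d) (ι (+ suc d)))
  (ℚᵘ.≃-trans (ℚᵘ.*-cong (Q.toℚᵘ-fromℚᵘ (ℚᵘ.mkℚᵘ z d)) (toℚᵘ-ι (+ suc d)))
    (ℚᵘ.≃-trans (ℚᵘ.*≡* cross) (ℚᵘ.≃-sym (toℚᵘ-ι z)))))
  where
  cross : z ℤ.* + suc d ℤ.* 1ℤ ≡ z ℤ.* + (suc d * 1)
  cross = trans (ℤ.*-identityʳ _) (cong (λ k → z ℤ.* + k) (sym (ℕ.*-identityʳ (suc d))))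

-- Both sides of the density inequality are multiplied by 12 ^ n.
centerDensityExceeds : ∀ s e m p D {G : Matrix (s + s)} → det (s + s) G ≡ ι (+ D) →
  (p + 1) ^ s * (p + 1) ^ s * D < (m * 3) ^ (s + s) * (p ^ e * p ^ e) →
  CenterDensityExceeds (s + s) G (ι (+ m))
    ((+ (p + 1) Q./ 12) ^ℚ s) ((+ p Q./ 1) ^ℚ e)
centerDensityExceeds s e m p D {G} det-G lt =
  Q.*-cancelʳ-<-nonNeg (c ^ℚ (s + s)) {{subst Q.NonNegative (ι-^ 12 (s + s)) ι-nonNeg}}
    (subst₂ Q._<_ (sym lhs) (sym rhs) (ι-mono-< {+ _} {+ _} (ℤ.+<+ lt)))
  where
  c = ι (+ 12)
  b = ι (+ p) ^ℚ e
  a = (+ (p + 1) Q./ 12) ^ℚ s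
  μ = ι (+ m) Q.* (+ 1 Q./ 4)

  ι-nonNeg : Q.NonNegative (ι (+ (12 ^ (s + s))))
  ι-nonNeg = Q.nonNegative (ι-mono-≤ {+ 0} {+ (12 ^ (s + s))} (ℤ.+≤+ z≤n))

  a*c : a Q.* (c ^ℚ s) ≡ ι (+ ((p + 1) ^ s))
  a*c = trans (sym (^ℚ-distrib-* (+ (p + 1) Q./ 12) c s))
    (trans (cong (_^ℚ s) (/-*-cancel (+ (p + 1)) 11)) (sym (ι-^ (p + 1) s)))

  lhs : a Q.* a Q.* det (s + s) G Q.* (c ^ℚ (s + s)) ≡ ι (+ ((p + 1) ^ s * (p + 1) ^ s * D))
  lhs = trans (cong₂ (λ d t → a Q.* a Q.* d Q.* t) det-G (^ℚ-+ c s s))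
    (trans (regroup a (ι (+ D)) (c ^ℚ s))
      (trans (cong (λ z → z Q.* z Q.* ι (+ D)) a*c)
        (sym (trans (ι-ℕ-* (k * k) D) (cong (Q._* ι (+ D)) (ι-ℕ-* k k))))))
    where
    k = (p + 1) ^ s
    regroup : ∀ a d t → a Q.* a Q.* d Q.* (t Q.* t) ≡ a Q.* t Q.* (a Q.* t) Q.* d
    regroup = solve-∀ ℚ-ring

  μ*c : μ Q.* c ≡ ι (+ (m * 3))
  μ*c = trans (Q.*-assoc (ι (+ m)) (+ 1 Q./ 4) c) (sym (ι-ℕ-* m 3))

  rhs : (μ ^ℚ (s + s)) Q.* (b Q.* b) Q.* (c ^ℚ (s + s))
      ≡ ι (+ ((m * 3) ^ (s + s) * (p ^ e * p ^ e)))
  rhs = trans (regroup (μ ^ℚ (s + s)) b (c ^ℚ (s + s)))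
    (trans (cong (Q._* (b Q.* b)) (trans (sym (^ℚ-distrib-* μ c (s + s)))
             (trans (cong (_^ℚ (s + s)) μ*c) (sym (ι-^ (m * 3) (s + s))))))
      (sym (trans (ι-ℕ-* ((m * 3) ^ (s + s)) (p ^ e * p ^ e))
        (cong (ι (+ ((m * 3) ^ (s + s))) Q.*_) (trans (ι-ℕ-* (p ^ e) (p ^ e))
          (cong (λ z → z Q.* z) (ι-^ p e)))))))
    where
    regroup : ∀ u b t → u Q.* (b Q.* b) Q.* t ≡ u Q.* t Q.* (b Q.* b)
    regroup = solve-∀ ℚ-ring

-- 37 ^ exponent p has to exceed the number of vectors to be avoided and to stay below the
-- largest volume with the required density; 95 / 63 bounds Σ 4^(-x²).
exponent : ℕ → ℕ
exponent p = 2 + (p / 3 + 388)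

-- The first inequality is the counting hypothesis of `denseLattice`; the second is the cleared
-- density inequality for minimal norm `37 * 37` and the determinant obtained there.
Feasible : ℕ → Set
Feasible p =
    95 ^ n * 4 ^ (37 * 37 ∸ 1) < 37 ^ exponent p * 63 ^ n
  × (p + 1) ^ s * (p + 1) ^ s * (37 ^ exponent p * 37 ^ exponent p)
      < (37 * 37 * 3) ^ n * (p ^ e * p ^ e)
  where
  s = p ∸ 1
  n = s + s
  e = (p ∸ 5) / 6

feasible? : Decidable Feasible
feasible? p = (_ ℕ.<? _) ×-dec (_ ℕ.<? _)

-- Settled by evaluating the decision procedure; `373 = 2039 - 1667 + 1` is the length of the range.
feasible : ∀ {i} → i < 373 → Feasible (1667 + i)
feasible = toWitness {a? = ℕ.allUpTo? (λ i → feasible? (1667 + i)) 373} _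

-- The series is about 1.50782 and `95 / 63` about 1.50794. Base 4 suits the range: under the
-- weights 4^(-x²) the mean of x² is about 0.35, while `37 * 37 / n` lies between 0.33 and 0.42.
thetaSum-37 : thetaSum 37 * 63 ≤ 95 * 4 ^ (37 * 37)
thetaSum-37 = toWitness {a? = thetaSum 37 * 63 ℕ.≤? 95 * 4 ^ (37 * 37)} _

theorem6p3 : (p : ℕ) → Prime p → p % 6 ≡ 5 → 1667 ≤ p → p ≤ 2039 →
    Σ (Matrix (2 * p ∸ 2)) (λ G → Σ ℚ (λ m →
    IsGram (2 * p ∸ 2) G × IsMinNormSq (2 * p ∸ 2) G m ×
    CenterDensityExceeds (2 * p ∸ 2) G m
    ((+ (p + 1) Data.Rational./ 12) ^ℚ (p ∸ 1))
    ((+ p Data.Rational./ 1) ^ℚ ((p ∸ 5) / 6))))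
theorem6p3 p _ _ 1667≤p p≤2039 = subst Claim dimension
  (G , ι (+ (37 * 37)) , isGram , isMin ,
   centerDensityExceeds (p ∸ 1) ((p ∸ 5) / 6) (37 * 37) p _ {G} det-G (proj₂ feasible-p))
  where
  Claim : ℕ → Set
  Claim n = Σ (Matrix n) (λ G → Σ ℚ (λ m → IsGram n G × IsMinNormSq n G m ×
    CenterDensityExceeds n G m
      ((+ (p + 1) Q./ 12) ^ℚ (p ∸ 1)) ((+ p Q./ 1) ^ℚ ((p ∸ 5) / 6))))

  s = p ∸ 1

  -- The lattice is built in dimension `s + s`, where `n`-th powers split into two `s`-th powers,
  -- and then transported.
  dimension : s + s ≡ 2 * p ∸ 2
  dimension = trans (cong (_+_ s) (sym (ℕ.+-identityʳ s))) (ℕ.*-distribˡ-∸ 2 p 1)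

  feasible-p : Feasible p
  feasible-p = subst Feasible (ℕ.m+[n∸m]≡n 1667≤p)
    (feasible (s≤s (ℕ.∸-monoˡ-≤ 1667 p≤2039)))

  1≤s : 1 ≤ s
  1≤s = ℕ.∸-monoˡ-≤ 1 (ℕ.≤-trans (ℕ.m≤m+n 2 1665) 1667≤p)

  lattice = denseLattice 37 (p / 3 + 388) 63 95
    (toWitness {a? = prime? 37} _) thetaSum-37 (ℕ.m≤m+n 63 32)
    (s + s) (ℕ.+-mono-≤ 1≤s 1≤s) (proj₁ feasible-p)

  G = proj₁ lattice
  isGram = proj₁ (proj₂ lattice)
  isMin = proj₁ (proj₂ (proj₂ lattice))
  det-G = proj₂ (proj₂ (proj₂ lattice))
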